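{- Let $m \geq 1$ be an integer and let the edges of the complete graph $K_{2m}$ be properly colored with $2m-1$ colors. Then $K_{2m}$ contains at least $\left\lfloor \frac{\sqrt{6m+9}}{3} \right\rfloor$ pairwise edge-disjoint rainbow spanning trees.
   Context: A proper edge-coloring of a graph assigns colors to edges so that any two edges sharing a vertex receive distinct colors. A subgraph of an edge-colored graph is rainbow if all of its edges receive distinct colors. A spanning tree of $K_{2m}$ is an acyclic connected subgraph containing all $2m$ vertices. -}

module Defs where

open import Data.Nat using (ℕ; suc; _≥_)
open import Data.Fin using (Fin) renaming (_<_ to _<ᶠ_)
open import Data.Product using (Σ; _×_; ∃; ∃-syntax; _,_)
open import Data.Sum using (_⊎_)
open import Data.List using (List; []; _∷_; length; map)
open import Data.List.Membership.Propositional using (_∈_; _∉_)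
open import Data.List.Relation.Unary.Unique.Propositional using (Unique)
open import Relation.Binary.PropositionalEquality using (_≡_; _≢_)
open import Relation.Nullary using (¬_)

-- An edge of the complete graph K_n on vertex set Fin n:
-- an unordered pair {u , v} of distinct vertices, stored with u < v.
record Edge (n : ℕ) : Set where
  constructor edge
  field
    u v : Fin n
    u<v : u <ᶠ v
open Edge public

_∈ₑ_ : ∀ {n} → Fin n → Edge n → Set
x ∈ₑ e = x ≡ u e ⊎ x ≡ v e

ShareVertex : ∀ {n} → Edge n → Edge n → Set
ShareVertex e f = ∃[ x ] (x ∈ₑ e × x ∈ₑ f)

Colouring : ℕ → ℕ → Set
Colouring n k = Edge n → Fin k

Proper : ∀ {n k} → Colouring n k → Set
Proper c = ∀ e f → e ≢ f → ShareVertex e f → c e ≢ c f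

Subgraph : ℕ → Set
Subgraph n = List (Edge n)

Adj : ∀ {n} → Subgraph n → Fin n → Fin n → Set
Adj T x y = ∃[ e ] (e ∈ T × ((x ≡ u e × y ≡ v e) ⊎ (x ≡ v e × y ≡ u e)))

data Walk {n} (T : Subgraph n) : Fin n → Fin n → Set where
  here : ∀ {x} → Walk T x x
  step : ∀ {x y z} → Adj T x y → Walk T y z → Walk T x z

Connected : ∀ {n} → Subgraph n → Set
Connected {n} T = (x y : Fin n) → Walk T x y

data ClosedChain {n} (T : Subgraph n) (first : Fin n) : List (Fin n) → Set where
  last : ∀ {x} → Adj T x first → ClosedChain T first (x ∷ [])
  cons : ∀ {x y xs} → Adj T x y → ClosedChain T first (y ∷ xs) → ClosedChain T first (x ∷ y ∷ xs)

HasCycle : ∀ {n} → Subgraph n → Set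
HasCycle {n} T = Σ (Fin n) λ x₀ → Σ (List (Fin n)) λ xs →
  length (x₀ ∷ xs) ≥ 3 × Unique (x₀ ∷ xs) × ClosedChain T x₀ (x₀ ∷ xs)

Acyclic : ∀ {n} → Subgraph n → Set
Acyclic T = ¬ HasCycle T

SpanningTree : ∀ {n} → Subgraph n → Set
SpanningTree T = Unique T × Connected T × Acyclic T

Rainbow : ∀ {n k} → Colouring n k → Subgraph n → Set
Rainbow c T = Unique (map c T)

EdgeDisjoint : ∀ {n} → Subgraph n → Subgraph n → Set
EdgeDisjoint S T = ∀ e → e ∈ S → e ∉ T

{-# OPTIONS --safe #-}
module Submission where

-- A proper colouring of K_n with n − 1 colours shows every colour at every vertex, so every star is a
-- rainbow spanning tree. Start from the stars at k vertices x₁, …, x_k; two of them share only the edge xᵢxⱼ.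
-- An exchange in a tree with root r replaces the edges ra, rb by aa′, bb′, where aa′ has the colour of rb and
-- bb′ the colour of ra: the tree stays rainbow, and stays spanning if a′, b′ hang directly from r.
-- The conflict between Tᵢ and Tⱼ is resolved by an exchange of a = xⱼ, b = z in Tᵢ, which uses an edge xⱼy of Tⱼ,
-- followed by an exchange of y and a further vertex w in Tⱼ, which gives up that edge.
-- Each tree takes part in at most k − 1 exchanges, so at most 2 + 20(k − 2) vertices are unsuitable as z and at
-- most 5 + 17(k − 2) as w; both numbers are below 3k² − 3 ≤ n.

open import Defs
open import Data.Empty using (⊥; ⊥-elim)
open import Data.Fin using (Fin; zero; suc; punchIn; punchOut; inject≤)
open import Data.Fin.Properties using (_≟_; any?; all?; <-cmp; <-asym; <-irrefl; <-irrelevant; injective⇒≤; punchOut-injective; punchIn-injective; punchInᵢ≢i; punchIn-punchOut; suc-injective; inject≤-injective)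
open import Data.List using (List; []; _∷_; _++_; length; lookup; concatMap; tabulate; allFin; cartesianProduct)
open import Data.List.Membership.DecPropositional using (_∈?_)
open import Data.List.Membership.Propositional using (_∈_; _∉_)
open import Data.List.Membership.Propositional.Properties using (∈-++⁺ˡ; ∈-++⁺ʳ; ∈-concatMap⁺; ∈-tabulate⁺; ∈-tabulate⁻; ∈-allFin; ∈-cartesianProduct⁺)
open import Data.List.Properties using (length-++; length-tabulate; map-tabulate)
open import Data.List.Relation.Unary.All using (All; []; _∷_)
open import Data.List.Relation.Unary.All.Properties using (¬Any⇒All¬) renaming (tabulate⁺ to All-tabulate⁺)
open import Data.List.Relation.Unary.AllPairs using (AllPairs; []; _∷_)
open import Data.List.Relation.Unary.AllPairs.Properties using () renaming (tabulate⁺ to AllPairs-tabulate⁺)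
open import Data.List.Relation.Unary.Any using (Any; here; there; index)
open import Data.List.Relation.Unary.Any.Properties using (lookup-index) renaming (tabulate⁺ to Any-tabulate⁺)
open import Data.List.Relation.Unary.Unique.Propositional using (Unique)
open import Data.List.Relation.Unary.Unique.Propositional.Properties using () renaming (tabulate⁺ to Unique-tabulate⁺)
open import Data.Nat using (ℕ; zero; suc; _+_; _*_; _∸_; _≤_; _<_; _≥_; z≤n; s≤s)
open import Data.Nat.Properties using (≤-trans; ≤-reflexive; ≤⇒≯; n≮n; +-monoˡ-≤; +-monoʳ-≤; *-cancelˡ-≤; +-cancelʳ-≤; m≤m+n; m≤m*n; n≤1+n)
open import Data.Nat.Tactic.RingSolver using (solve-∀)
open import Data.Product using (Σ; ∃; _×_; _,_; proj₁; proj₂)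
open import Data.Sum using (_⊎_; inj₁; inj₂; [_,_]′; swap) renaming (map to map-⊎)
open import Function using (_∘_)
open import Relation.Binary.Definitions using (tri<; tri≈; tri>)
open import Relation.Binary.PropositionalEquality using (_≡_; _≢_; refl; sym; trans; cong; cong₂; subst)
open import Relation.Nullary using (¬_; Dec; yes; no; contradiction; ¬?; _×-dec_)

-- Pigeonhole arguments.

abstract
  -- Punching out a missed value `d` would inject `Fin (suc n)` into `Fin n`.
  injective⇒surjective : ∀ {n} (f : Fin n → Fin n) → (∀ {a b} → f a ≡ f b → a ≡ b) → ∀ d → ∃ λ a → f a ≡ d
  injective⇒surjective {suc n} f inj d with any? (λ a → f a ≟ d)
  ... | yes found = found
  ... | no none = contradiction (injective⇒≤ {f = λ a → punchOut (d≢f a)} (λ {a} {b} → inj ∘ punchOut-injective (d≢f a) (d≢f b))) (n≮n n)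
    where
    d≢f : ∀ a → d ≢ f a
    d≢f a e = none (a , sym e)

-- If `xs` held every vertex, positions in `xs` would inject `Fin n` into `Fin (length xs)`.
∃-outside : ∀ {n} (xs : List (Fin n)) → length xs < n → ∃ λ v → v ∉ xs
∃-outside {n} xs short with any? (λ v → ¬? (_∈?_ _≟_ v xs))
... | yes found = found
... | no none = contradiction short (≤⇒≯ (injective⇒≤ {f = λ v → index (mem v)} index-inj))
  where
  mem : ∀ v → v ∈ xs
  mem v with _∈?_ _≟_ v xs
  ... | yes v∈ = v∈
  ... | no v∉ = ⊥-elim (none (v , v∉))
  index-inj : ∀ {v w} → index (mem v) ≡ index (mem w) → v ≡ w
  index-inj {v} {w} e = trans (lookup-index (mem v)) (trans (cong (lookup xs) e) (sym (lookup-index (mem w))))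

length-concatMap : ∀ {A B : Set} (f : A → List B) {s} → (∀ a → length (f a) ≡ s) → ∀ xs → length (concatMap f xs) ≡ length xs * s
length-concatMap f eq [] = refl
length-concatMap f eq (x ∷ xs) = trans (length-++ (f x)) (cong₂ _+_ (eq x) (length-concatMap f eq xs))

∉⇒All≢ : ∀ {A : Set} {v : A} {xs} → v ∉ xs → All (v ≢_) xs
∉⇒All≢ = ¬Any⇒All¬ _

others : ∀ {k} (i j : Fin k) → i ≢ j → ∃ λ q → k ≡ 2 + q × ∃ λ (g : Fin q → Fin k) → ∀ l → l ≢ i → l ≢ j → ∃ λ t → g t ≡ l
others {suc zero} zero zero i≢j = contradiction refl i≢j
others {suc (suc q)} i j i≢j = q , refl , (λ t → punchIn i (punchIn j′ t)) , λ l l≢i l≢j →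
  punchOut {i = j′} {punchOut {i = i} (l≢i ∘ sym)} (l≢j ∘ sym ∘ punchOut-injective i≢j (l≢i ∘ sym)) ,
  trans (cong (punchIn i) (punchIn-punchOut _)) (punchIn-punchOut (l≢i ∘ sym))
  where j′ = punchOut {i = i} i≢j

abstract
  -- Only the `k - 2` indices other than `i` and `j` contribute a block, so at most
  -- `length base + (k - 2) * s` vertices are excluded.
  avoid : ∀ {n k} (i j : Fin k) → i ≢ j → (base : List (Fin n)) (block : Fin k → List (Fin n)) (s : ℕ) →
    (∀ l → length (block l) ≡ s) → (∀ q → k ≡ 2 + q → length base + q * s < n) →
    ∃ λ v → All (v ≢_) base × (∀ l → l ≢ i → l ≢ j → All (v ≢_) (block l))
  avoid {n} i j i≢j base block s len bound with others i j i≢j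
  ... | q , k≡ , g , onto with ∃-outside (base ++ concatMap block (tabulate g)) (subst (_< n) (sym total) (bound q k≡))
    where
    total : length (base ++ concatMap block (tabulate g)) ≡ length base + q * s
    total = trans (length-++ base) (cong (length base +_) (trans (length-concatMap block len (tabulate g)) (cong (_* s) (length-tabulate g))))
  ... | v , v∉ = v , ∉⇒All≢ (v∉ ∘ ∈-++⁺ˡ) , λ l l≢i l≢j → ∉⇒All≢ λ v∈ → v∉ (∈-++⁺ʳ base (∈-concatMap⁺ block (any-block l (onto l l≢i l≢j) v∈)))
    where
    any-block : ∀ l → (∃ λ t → g t ≡ l) → v ∈ block l → Any ((v ∈_) ∘ block) (tabulate g)
    any-block l (t , refl) = Any-tabulate⁺ t

-- Function update and unordered pairs.

upd : ∀ {m} {B : Set} → (Fin m → B) → Fin m → B → Fin m → B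
upd f a b c with c ≟ a
... | yes _ = b
... | no _ = f c

upd-≡ : ∀ {m} {B : Set} (f : Fin m → B) a b → upd f a b a ≡ b
upd-≡ f a b with a ≟ a
... | yes _ = refl
... | no a≢a = contradiction refl a≢a

upd-≢ : ∀ {m} {B : Set} (f : Fin m → B) {a} b {c} → c ≢ a → upd f a b c ≡ f c
upd-≢ f {a} b {c} c≢a with c ≟ a
... | yes c≡a = contradiction c≡a c≢a
... | no _ = refl

SameEnds : ∀ {A : Set} → A → A → A → A → Set
SameEnds v v′ w w′ = (v ≡ w × v′ ≡ w′) ⊎ (v ≡ w′ × v′ ≡ w)

SameEnds-sym : ∀ {A : Set} {v v′ w w′ : A} → SameEnds v v′ w w′ → SameEnds w w′ v v′
SameEnds-sym (inj₁ (refl , refl)) = inj₁ (refl , refl)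
SameEnds-sym (inj₂ (refl , refl)) = inj₂ (refl , refl)

-- Symmetric Latin squares with constant diagonal.

module Packing {n k : ℕ} (col : Fin n → Fin n → Fin n)
  (col-sym : ∀ a b → col a b ≡ col b a)
  (col-inj : ∀ {a b c} → col a b ≡ col a c → b ≡ c)
  (col-diag : ∀ a b → col a a ≡ col b b)
  (x : Fin k → Fin n) (x-inj : ∀ {i j} → x i ≡ x j → i ≡ j) where

  V : Set
  V = Fin n

  -- The other end of the edge of colour `d` at `a`; it is `a` itself for the diagonal colour.
  nb : V → Fin n → V
  nb a d = proj₁ (injective⇒surjective (col a) col-inj d)

  col-nb : ∀ a d → col a (nb a d) ≡ d
  col-nb a d = proj₂ (injective⇒surjective (col a) col-inj d)

  nb-unique : ∀ {a b d} → col a b ≡ d → b ≡ nb a d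
  nb-unique e = col-inj (trans e (sym (col-nb _ _)))

  col-injˡ : ∀ {a b c} → col b a ≡ col c a → b ≡ c
  col-injˡ {a} {b} {c} e = col-inj (trans (col-sym a b) (trans e (col-sym c a)))

  -- For fixed `d` the map `nb _ d` is an involution, so forbidding it one value `t` costs one
  -- vertex `v`.
  nb-avoid : ∀ {v t d} → v ≢ nb t d → nb v d ≢ t
  nb-avoid {v} {t} {d} v≢ refl = v≢ (nb-unique (trans (col-sym t v) (col-nb v d)))

  -- The edge at `b` with the colour of `av` ends in `t` for a single `v`, so this too costs one
  -- vertex.
  nb-col-avoid : ∀ {v a b t} → v ≢ nb a (col b t) → nb b (col a v) ≢ t
  nb-col-avoid {v} {a} {b} v≢ refl = v≢ (nb-unique (sym (col-nb b (col a v))))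

  SameEnds-col : ∀ {v v′ w w′} → SameEnds v v′ w w′ → col v v′ ≡ col w w′
  SameEnds-col (inj₁ (refl , refl)) = refl
  SameEnds-col (inj₂ (refl , refl)) = col-sym _ _

  -- Rainbow trees of depth at most two.

  NonRoot : V → Set
  NonRoot v = ∀ l → v ≢ x l

  nonRoot? : ∀ v → Dec (NonRoot v)
  nonRoot? v = all? λ l → ¬? (v ≟ x l)

  _∈ᶠ_ : V → (Fin k → V) → Set
  v ∈ᶠ C = ∃ λ m → v ≡ C m

  -- Roots are exempt: the degree bound concerns non-root neighbours only, and a root entering the
  -- list then needs no check on its new parent.
  InjOn : V → (V → V) → (Fin k → V) → Set
  InjOn r p C = ∀ {v w} → v ∈ᶠ C → w ∈ᶠ C → NonRoot v → NonRoot w → p v ≢ r → p v ≡ p w → v ≡ w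

  -- p is the parent map of a tree of depth at most two with root x i. The vertices not hanging directly from the
  -- root are listed by A and B: the exchange that resolves the conflict with tree l moved A l and B l,
  -- and A l = B l = x i as long as there was none. Injectivity on the two lists bounds the degrees away
  -- from the root.
  record Tree (i : Fin k) : Set where
    field
      p : V → V
      A B : Fin k → V
      root : p (x i) ≡ x i
      depth : ∀ v → p (p v) ≡ x i
      rainbow : ∀ {v w} → col v (p v) ≡ col w (p w) → v ≡ w
      parents : ∀ {v l} → p v ≡ x l → p v ≡ x i
      moved : ∀ v → p v ≡ x i ⊎ (v ∈ᶠ A ⊎ v ∈ᶠ B)
      injA : InjOn (x i) p A
      injB : InjOn (x i) p B
  open Tree

  Avoids : V → (Fin k → V) → Set
  Avoids v C = ∀ m → v ≢ C m

  unmoved⇒p≡root : ∀ {i} (T : Tree i) {v} → Avoids v (A T) → Avoids v (B T) → p T v ≡ x i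
  unmoved⇒p≡root T {v} v∉A v∉B with moved T v
  ... | inj₁ e = e
  ... | inj₂ (inj₁ (m , e)) = contradiction e (v∉A m)
  ... | inj₂ (inj₂ (m , e)) = contradiction e (v∉B m)

  childless : ∀ {i} (T : Tree i) {v} → v ≢ x i → Avoids v (p T ∘ A T) → Avoids v (p T ∘ B T) → ∀ u → p T u ≢ v
  childless T v≢ v∉A v∉B u refl with moved T u
  ... | inj₁ e = v≢ e
  ... | inj₂ (inj₁ (m , refl)) = v∉A m refl
  ... | inj₂ (inj₂ (m , refl)) = v∉B m refl

  abstract
    -- The root contributes the diagonal colour, so the `n` vertices give `n` distinct colours
    -- `col v (p v)`, which exhaust `Fin n`.
    colour-unique : ∀ {i} (T : Tree i) d → ∃ λ e → ∀ {v} → col v (p T v) ≡ d → v ≡ e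
    colour-unique T d with injective⇒surjective (λ v → col v (p T v)) (rainbow T) d
    ... | e , e-col = e , λ v-col → rainbow T (trans v-col (sym e-col))

  -- Injectivity on `C` leaves `y` at most one non-root child there.
  class-child : ∀ {r p C} → InjOn r p C → ∀ y → y ≢ r → ∃ λ t → ∀ {v} → NonRoot v → v ∈ᶠ C → p v ≡ y → v ≡ t
  class-child {r} {p} {C} inj y y≢r with any? (λ m → nonRoot? (C m) ×-dec (p (C m) ≟ y))
  ... | yes (m , nr , e) = C m , λ nr′ v∈ e′ → inj v∈ (m , refl) nr′ nr (λ pv≡r → y≢r (trans (sym e′) pv≡r)) (trans e′ (sym e))
  -- No child exists, so the witness is arbitrary.
  ... | no none = y , λ { nr (m , refl) e → contradiction (m , nr , e) none }

  abstract
    -- By the depth bound a vertex not hanging from the root is a leaf, with its parent as only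
    -- neighbour. A vertex hanging from the root has, besides the root, only children: at most one
    -- non-root child from each list.
    tree-neighbours : ∀ {i} (T : Tree i) y → NonRoot y →
      ∃ λ t₁ → ∃ λ t₂ → ∀ {v} → NonRoot v → p T y ≡ v ⊎ p T v ≡ y → v ≡ t₁ ⊎ v ≡ t₂
    tree-neighbours {i} T y y∉X with p T y ≟ x i
    ... | no py≢ = p T y , y , λ
      { _ (inj₁ e) → inj₁ (sym e)
      ; {v} _ (inj₂ refl) → contradiction (depth T v) py≢ }
    ... | yes py≡ with class-child (injA T) y (y∉X i) | class-child (injB T) y (y∉X i)
    ... | t₁ , only₁ | t₂ , only₂ = t₁ , t₂ , nbrs
      where
      nbrs : ∀ {v} → NonRoot v → p T y ≡ v ⊎ p T v ≡ y → v ≡ t₁ ⊎ v ≡ t₂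
      nbrs v∉X (inj₁ e) = contradiction (trans (sym e) py≡) (v∉X i)
      nbrs {v} v∉X (inj₂ e) with moved T v
      ... | inj₁ pv≡ = contradiction (trans (sym e) pv≡) (y∉X i)
      ... | inj₂ (inj₁ v∈) = inj₁ (only₁ v∉X v∈ e)
      ... | inj₂ (inj₂ v∈) = inj₂ (only₂ v∉X v∈ e)

  -- Only `c` and `d` change parents. The vertex `d` is not listed among the non-roots, and a
  -- non-root `c` receives a parent that no listed vertex had.
  InjOn-upd : ∀ {r p p′ C s c d} → InjOn r p C → (∀ {v} → v ≢ c → v ≢ d → p′ v ≡ p v) →
    (∀ {v} → NonRoot v → v ∈ᶠ C → v ≢ d) → (NonRoot c → ∀ {v} → v ∈ᶠ C → p v ≢ p′ c) →
    InjOn r p′ (upd C s c)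
  InjOn-upd {r} {p} {p′} {C} {s} {c} {d} inj same d∉ c-new {v} {w} v∈ w∈ v∉X w∉X pv≢r pv≡pw = go (back v∈) (back w∈)
    where
    back : ∀ {u} → u ∈ᶠ upd C s c → u ≡ c ⊎ u ≢ c × u ∈ᶠ C
    back {u} (m , e) with u ≟ c
    ... | yes u≡c = inj₁ u≡c
    ... | no u≢c with m ≟ s
    ... | yes _ = contradiction e u≢c
    ... | no _ = inj₂ (u≢c , m , e)
    same′ : ∀ {u} → NonRoot u → u ≢ c × u ∈ᶠ C → p′ u ≡ p u
    same′ u∉X (u≢c , u∈) = same u≢c (d∉ u∉X u∈)
    go : v ≡ c ⊎ v ≢ c × v ∈ᶠ C → w ≡ c ⊎ w ≢ c × w ∈ᶠ C → v ≡ w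
    go (inj₁ e) (inj₁ e′) = trans e (sym e′)
    go (inj₁ refl) (inj₂ w∈′) = contradiction (trans (sym (same′ w∉X w∈′)) (sym pv≡pw)) (c-new v∉X (proj₂ w∈′))
    go (inj₂ v∈′) (inj₁ refl) = contradiction (trans (sym (same′ v∉X v∈′)) pv≡pw) (c-new w∉X (proj₂ v∈′))
    go (inj₂ v∈′) (inj₂ w∈′) = inj (proj₂ v∈′) (proj₂ w∈′) v∉X w∉X (λ e → pv≢r (trans (same′ v∉X v∈′) e))
      (trans (sym (same′ v∉X v∈′)) (trans pv≡pw (same′ w∉X w∈′)))

  -- The exchange of two edges at the root.

  module Exchange {i : Fin k} (T : Tree i) (a b : V) (s : Fin k)
    (As : A T s ≡ x i) (Bs : B T s ≡ x i)
    (a≢r : a ≢ x i) (b≢r : b ≢ x i) (a≢b : a ≢ b)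
    (pa : p T a ≡ x i) (pb : p T b ≡ x i)
    (a-childless : ∀ u → p T u ≢ a) (b-childless : ∀ u → p T u ≢ b)
    (pa′ : p T (nb a (col (x i) b)) ≡ x i) (pb′ : p T (nb b (col (x i) a)) ≡ x i)
    (a′∉X : NonRoot (nb a (col (x i) b))) (b′∉X : NonRoot (nb b (col (x i) a)))
    (b∉A : Avoids b (A T)) (a∉B : NonRoot a → Avoids a (B T))
    (a′∉pA : NonRoot a → Avoids (nb a (col (x i) b)) (p T ∘ A T))
    (b′∉pB : Avoids (nb b (col (x i) a)) (p T ∘ B T)) where

    r a′ b′ : V
    r = x i
    a′ = nb a (col r b)
    b′ = nb b (col r a)

    p′ : V → V
    p′ = upd (upd (p T) a a′) b b′

    p′-a : p′ a ≡ a′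
    p′-a = trans (upd-≢ _ b′ a≢b) (upd-≡ _ a a′)

    p′-b : p′ b ≡ b′
    p′-b = upd-≡ _ b b′

    p′-≢ : ∀ {v} → v ≢ a → v ≢ b → p′ v ≡ p T v
    p′-≢ v≢a v≢b = trans (upd-≢ _ b′ v≢b) (upd-≢ _ a′ v≢a)

    data Position (v : V) : Set where
      at-a : v ≡ a → Position v
      at-b : v ≡ b → Position v
      away : v ≢ a → v ≢ b → Position v

    position : ∀ v → Position v
    position v with v ≟ a | v ≟ b
    ... | yes e | _ = at-a e
    ... | no _ | yes e = at-b e
    ... | no v≢a | no v≢b = away v≢a v≢b

    -- Otherwise `rb` would have the diagonal colour, forcing `b = r`.
    a′≢a : a′ ≢ a
    a′≢a e = b≢r (sym (col-inj (trans (col-diag r a) (trans (cong (col a) (sym e)) (col-nb a _)))))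

    b′≢b : b′ ≢ b
    b′≢b e = a≢r (sym (col-inj (trans (col-diag r b) (trans (cong (col b) (sym e)) (col-nb b _)))))

    -- Otherwise `ab` and `rb` would have the same colour at `b`.
    a′≢b : a′ ≢ b
    a′≢b e = a≢r (col-injˡ (trans (cong (col a) (sym e)) (col-nb a _)))

    b′≢a : b′ ≢ a
    b′≢a e = b≢r (col-injˡ (trans (cong (col b) (sym e)) (col-nb b _)))

    colour-a : col a (p′ a) ≡ col b (p T b)
    colour-a = trans (cong (col a) p′-a) (trans (col-nb a _) (trans (col-sym r b) (cong (col b) (sym pb))))

    colour-b : col b (p′ b) ≡ col a (p T a)
    colour-b = trans (cong (col b) p′-b) (trans (col-nb b _) (trans (col-sym r a) (cong (col a) (sym pa))))

    depth′ : ∀ v → p′ (p′ v) ≡ r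
    depth′ v with position v
    ... | at-a refl = trans (cong p′ p′-a) (trans (p′-≢ a′≢a a′≢b) pa′)
    ... | at-b refl = trans (cong p′ p′-b) (trans (p′-≢ b′≢a b′≢b) pb′)
    ... | away v≢a v≢b = trans (cong p′ (p′-≢ v≢a v≢b)) (trans (p′-≢ (a-childless v) (b-childless v)) (depth T v))

    rainbow′ : ∀ {v w} → col v (p′ v) ≡ col w (p′ w) → v ≡ w
    rainbow′ {v} {w} e with position v | position w
    ... | at-a refl | at-a refl = refl
    ... | at-b refl | at-b refl = refl
    ... | at-a refl | at-b refl = sym (rainbow T (trans (sym colour-a) (trans e colour-b)))
    ... | at-b refl | at-a refl = sym (rainbow T (trans (sym colour-b) (trans e colour-a)))
    ... | at-a refl | away w≢a w≢b = contradiction (sym (rainbow T (trans (sym colour-a) (trans e (cong (col w) (p′-≢ w≢a w≢b)))))) w≢b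
    ... | at-b refl | away w≢a w≢b = contradiction (sym (rainbow T (trans (sym colour-b) (trans e (cong (col w) (p′-≢ w≢a w≢b)))))) w≢a
    ... | away v≢a v≢b | at-a refl = contradiction (rainbow T (trans (cong (col v) (sym (p′-≢ v≢a v≢b))) (trans e colour-a))) v≢b
    ... | away v≢a v≢b | at-b refl = contradiction (rainbow T (trans (cong (col v) (sym (p′-≢ v≢a v≢b))) (trans e colour-b))) v≢a
    ... | away v≢a v≢b | away w≢a w≢b = rainbow T (trans (cong (col v) (sym (p′-≢ v≢a v≢b))) (trans e (cong (col w) (p′-≢ w≢a w≢b))))

    parents′ : ∀ {v l} → p′ v ≡ x l → p′ v ≡ r
    parents′ {v} {l} e with position v
    ... | at-a refl = contradiction (trans (sym p′-a) e) (a′∉X l)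
    ... | at-b refl = contradiction (trans (sym p′-b) e) (b′∉X l)
    ... | away v≢a v≢b = trans (p′-≢ v≢a v≢b) (parents T (trans (sym (p′-≢ v≢a v≢b)) e))

    root′ : p′ r ≡ r
    root′ = trans (p′-≢ (a≢r ∘ sym) (b≢r ∘ sym)) (root T)

    -- Overwriting slot `s` loses no moved vertex, since the slot held only the root.
    keeps : ∀ {C v} c → C s ≡ r → v ∈ᶠ C → p′ v ≡ r ⊎ v ∈ᶠ upd C s c
    keeps {C} c Cs (m , e) with m ≟ s
    ... | yes refl = inj₁ (trans (cong p′ (trans e Cs)) root′)
    ... | no m≢s = inj₂ (m , trans e (sym (upd-≢ C c m≢s)))

    moved′ : ∀ v → p′ v ≡ r ⊎ (v ∈ᶠ upd (A T) s a ⊎ v ∈ᶠ upd (B T) s b)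
    moved′ v with position v
    ... | at-a refl = inj₂ (inj₁ (s , sym (upd-≡ _ s a)))
    ... | at-b refl = inj₂ (inj₂ (s , sym (upd-≡ _ s b)))
    ... | away v≢a v≢b with moved T v
    ... | inj₁ e = inj₁ (trans (p′-≢ v≢a v≢b) e)
    ... | inj₂ (inj₁ v∈) = [ inj₁ , inj₂ ∘ inj₁ ]′ (keeps a As v∈)
    ... | inj₂ (inj₂ v∈) = [ inj₁ , inj₂ ∘ inj₂ ]′ (keeps b Bs v∈)

    exchange : Tree i
    exchange = record
      { p = p′ ; A = upd (A T) s a ; B = upd (B T) s b
      ; root = root′ ; depth = depth′ ; rainbow = rainbow′ ; parents = λ {v} → parents′ {v} ; moved = moved′
      ; injA = InjOn-upd (injA T) p′-≢
          (λ { _ (m , e) refl → b∉A m e })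
          (λ a∉X → λ { (m , refl) e → a′∉pA a∉X m (trans (sym p′-a) (sym e)) })
      ; injB = InjOn-upd (injB T) (λ v≢b v≢a → p′-≢ v≢a v≢b)
          (λ { v∉X (m , e) refl → a∉B v∉X m e })
          (λ _ → λ { (m , refl) e → b′∉pB m (trans (sym p′-b) (sym e)) })
      }

  -- Families of trees that share at most the edges between their roots.

  Disj : ∀ {l m} → Tree l → Tree m → Set
  Disj {l} {m} T U = ∀ {v w} → SameEnds v (p T v) w (p U w) → v ≡ x m × w ≡ x l

  Disj-sym : ∀ {l m} {T : Tree l} {U : Tree m} → Disj T U → Disj U T
  Disj-sym d same with d (SameEnds-sym same)
  ... | e , e′ = e′ , e

  -- Slots are free as long as their conflict lasts. `Conflict i i` holds by `root`, so slot `i` of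
  -- tree `i` is always free.
  record State : Set where
    field
      tree : ∀ i → Tree i
    Conflict : Fin k → Fin k → Set
    Conflict i l = p (tree i) (x l) ≡ x i × p (tree l) (x i) ≡ x l
    field
      idle : ∀ i l → Conflict i l → A (tree i) l ≡ x i × B (tree i) l ≡ x i
      disj : ∀ l m → l ≢ m → Disj (tree l) (tree m)
  open State

  stars : State
  stars = record
    { tree = λ i → record
        { p = λ _ → x i ; A = λ _ → x i ; B = λ _ → x i
        ; root = refl ; depth = λ _ → refl ; rainbow = col-injˡ ; parents = λ _ → refl
        ; moved = λ _ → inj₁ refl
        ; injA = λ { (_ , refl) (_ , refl) _ _ _ _ → refl }
        ; injB = λ { (_ , refl) (_ , refl) _ _ _ _ → refl } }
    ; idle = λ _ _ _ → refl , refl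
    ; disj = λ { l m l≢m (inj₁ (_ , e)) → contradiction (x-inj e) l≢m
               ; l m l≢m (inj₂ (e , e′)) → e , sym e′ } }

  -- Resolving one conflict by two exchanges.

  module Resolve (S : State) (i j : Fin k) (i≢j : i ≢ j) (conflict : Conflict S i j)
    (bound₁ : ∀ q → k ≡ 2 + q → 2 + q * 20 < n) (bound₂ : ∀ q → k ≡ 2 + q → 5 + q * 17 < n) where

    Tᵢ : Tree i
    Tᵢ = tree S i
    Tⱼ : Tree j
    Tⱼ = tree S j

    xᵢ xⱼ : V
    xᵢ = x i
    xⱼ = x j

    xᵢ≢xⱼ : xᵢ ≢ xⱼ
    xᵢ≢xⱼ = i≢j ∘ x-inj

    for-all : {P : Fin k → Set} → P i → P j → (∀ l → l ≢ i → l ≢ j → P l) → ∀ l → P l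
    for-all Pi Pj Po l with l ≟ i | l ≟ j
    ... | yes refl | _ = Pi
    ... | no _ | yes refl = Pj
    ... | no l≢i | no l≢j = Po l l≢i l≢j

    nonRoot : ∀ {v} → v ≢ xᵢ → v ≢ xⱼ → (∀ l → l ≢ i → l ≢ j → v ≢ x l) → NonRoot v
    nonRoot = for-all

    -- Slots `i` and `j` yield only the root of the tree at hand, which is why the blocks below need
    -- only the other `k - 2` indices.
    avoids : ∀ {v r C} → C i ≡ r → C j ≡ r → v ≢ r → (∀ l → l ≢ i → l ≢ j → v ≢ C l) → Avoids v C
    avoids Ci Cj v≢r = for-all (λ e → v≢r (trans e Ci)) (λ e → v≢r (trans e Cj))

    Aᵢi : A Tᵢ i ≡ xᵢ
    Aᵢi = proj₁ (idle S i i (root Tᵢ , root Tᵢ))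
    Bᵢi : B Tᵢ i ≡ xᵢ
    Bᵢi = proj₂ (idle S i i (root Tᵢ , root Tᵢ))
    Aᵢj : A Tᵢ j ≡ xᵢ
    Aᵢj = proj₁ (idle S i j conflict)
    Bᵢj : B Tᵢ j ≡ xᵢ
    Bᵢj = proj₂ (idle S i j conflict)
    Aⱼi : A Tⱼ i ≡ xⱼ
    Aⱼi = proj₁ (idle S j i (proj₂ conflict , proj₁ conflict))
    Bⱼi : B Tⱼ i ≡ xⱼ
    Bⱼi = proj₂ (idle S j i (proj₂ conflict , proj₁ conflict))
    Aⱼj : A Tⱼ j ≡ xⱼ
    Aⱼj = proj₁ (idle S j j (root Tⱼ , root Tⱼ))
    Bⱼj : B Tⱼ j ≡ xⱼ
    Bⱼj = proj₂ (idle S j j (root Tⱼ , root Tⱼ))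

    pᵢ-root : ∀ {v} → v ≡ xᵢ → p Tᵢ v ≡ xᵢ
    pᵢ-root e = trans (cong (p Tᵢ) e) (root Tᵢ)
    pⱼ-root : ∀ {v} → v ≡ xⱼ → p Tⱼ v ≡ xⱼ
    pⱼ-root e = trans (cong (p Tⱼ) e) (root Tⱼ)

    α : Fin n
    α = col xᵢ xⱼ

    -- σ₁ t is the value of z for which z′ = t, and τ₁ t the one for which y = t.
    σ₁ τ₁ : V → V
    σ₁ t = nb t α
    τ₁ t = nb xᵢ (col xⱼ t)

    -- Each tree has one edge of colour `α`, the colour that `zz′` will have; a `z` off both its
    -- ends keeps `zz′` out of the tree.
    α-edge : ∀ l → ∃ λ e → ∀ {v} → col v (p (tree S l) v) ≡ α → v ≡ e
    α-edge l = colour-unique (tree S l) α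

    base₁ : List V
    base₁ = xᵢ ∷ xⱼ ∷ []

    -- By rows: `z` is an unmoved non-root leaf of `Tᵢ`; `z′` is unmoved in `Tᵢ`, not a root, and a
    -- new parent for the list `B`; `zz′` is not in tree `l`; `y` is an unmoved leaf of `Tᵢ`; `y` is
    -- an unmoved non-root leaf of `Tⱼ`.
    block₁ : Fin k → List V
    block₁ l =
      A Tᵢ l ∷ B Tᵢ l ∷ p Tᵢ (A Tᵢ l) ∷ p Tᵢ (B Tᵢ l) ∷ x l ∷
      σ₁ (A Tᵢ l) ∷ σ₁ (B Tᵢ l) ∷ σ₁ (p Tᵢ (B Tᵢ l)) ∷ σ₁ (x l) ∷
      proj₁ (α-edge l) ∷ p (tree S l) (proj₁ (α-edge l)) ∷
      τ₁ (A Tᵢ l) ∷ τ₁ (B Tᵢ l) ∷ τ₁ (p Tᵢ (A Tᵢ l)) ∷ τ₁ (p Tᵢ (B Tᵢ l)) ∷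
      τ₁ (A Tⱼ l) ∷ τ₁ (B Tⱼ l) ∷ τ₁ (p Tⱼ (A Tⱼ l)) ∷ τ₁ (p Tⱼ (B Tⱼ l)) ∷ τ₁ (x l) ∷ []

    abstract
      choice₁ : ∃ λ z → All (z ≢_) base₁ × (∀ l → l ≢ i → l ≢ j → All (z ≢_) (block₁ l))
      choice₁ = avoid i j i≢j base₁ block₁ 20 (λ _ → refl) bound₁

    -- In `Tᵢ` the edge `xⱼy` takes over the colour of `xᵢz`, and `zz′` the colour `α` of `xᵢxⱼ`.
    z z′ y : V
    z = proj₁ choice₁
    z′ = nb z α
    y = nb xⱼ (col xᵢ z)

    record Good₁ (l : Fin k) : Set where
      field
        z∉A : z ≢ A Tᵢ l
        z∉B : z ≢ B Tᵢ l
        z∉pA : z ≢ p Tᵢ (A Tᵢ l)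
        z∉pB : z ≢ p Tᵢ (B Tᵢ l)
        z≢x : z ≢ x l
        z′∉A : z′ ≢ A Tᵢ l
        z′∉B : z′ ≢ B Tᵢ l
        z′∉pB : z′ ≢ p Tᵢ (B Tᵢ l)
        z′≢x : z′ ≢ x l
        z≢e : z ≢ proj₁ (α-edge l)
        z≢pe : z ≢ p (tree S l) (proj₁ (α-edge l))
        y∉Aᵢ : y ≢ A Tᵢ l
        y∉Bᵢ : y ≢ B Tᵢ l
        y∉pAᵢ : y ≢ p Tᵢ (A Tᵢ l)
        y∉pBᵢ : y ≢ p Tᵢ (B Tᵢ l)
        y∉Aⱼ : y ≢ A Tⱼ l
        y∉Bⱼ : y ≢ B Tⱼ l
        y∉pAⱼ : y ≢ p Tⱼ (A Tⱼ l)
        y∉pBⱼ : y ≢ p Tⱼ (B Tⱼ l)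
        y≢x : y ≢ x l

    good₁ : ∀ l → l ≢ i → l ≢ j → Good₁ l
    good₁ l l≢i l≢j with proj₂ (proj₂ choice₁) l l≢i l≢j
    ... | c₁ ∷ c₂ ∷ c₃ ∷ c₄ ∷ c₅ ∷ c₆ ∷ c₇ ∷ c₈ ∷ c₉ ∷ c₁₀ ∷ c₁₁ ∷ c₁₂ ∷ c₁₃ ∷ c₁₄ ∷ c₁₅ ∷ c₁₆ ∷ c₁₇ ∷ c₁₈ ∷ c₁₉ ∷ c₂₀ ∷ [] = record
      { z∉A = c₁ ; z∉B = c₂ ; z∉pA = c₃ ; z∉pB = c₄ ; z≢x = c₅
      ; z′∉A = nb-avoid c₆ ; z′∉B = nb-avoid c₇ ; z′∉pB = nb-avoid c₈ ; z′≢x = nb-avoid c₉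
      ; z≢e = c₁₀ ; z≢pe = c₁₁
      ; y∉Aᵢ = nb-col-avoid c₁₂ ; y∉Bᵢ = nb-col-avoid c₁₃ ; y∉pAᵢ = nb-col-avoid c₁₄ ; y∉pBᵢ = nb-col-avoid c₁₅
      ; y∉Aⱼ = nb-col-avoid c₁₆ ; y∉Bⱼ = nb-col-avoid c₁₇ ; y∉pAⱼ = nb-col-avoid c₁₈ ; y∉pBⱼ = nb-col-avoid c₁₉
      ; y≢x = nb-col-avoid c₂₀ }

    module G₁ (l : Fin k) (l≢i : l ≢ i) (l≢j : l ≢ j) = Good₁ (good₁ l l≢i l≢j)

    z≢xᵢ : z ≢ xᵢ
    z≢xᵢ with proj₁ (proj₂ choice₁)
    ... | c ∷ _ = c

    z≢xⱼ : z ≢ xⱼ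
    z≢xⱼ with proj₁ (proj₂ choice₁)
    ... | _ ∷ c ∷ _ = c

    z∉X : NonRoot z
    z∉X = nonRoot z≢xᵢ z≢xⱼ G₁.z≢x

    z′∉X : NonRoot z′
    -- Both `σ₁` and `τ₁` swap `xᵢ` and `xⱼ`, so `base₁` already keeps `z′` and `y` off these two
    -- roots.
    z′∉X = nonRoot (nb-avoid (λ e → z≢xⱼ (trans e (sym (nb-unique refl)))))
      (nb-avoid (λ e → z≢xᵢ (trans e (sym (nb-unique (col-sym xⱼ xᵢ)))))) G₁.z′≢x

    y∉X : NonRoot y
    y∉X = nonRoot (nb-col-avoid (λ e → z≢xⱼ (trans e (sym (nb-unique (col-sym xᵢ xⱼ))))))
      (nb-col-avoid (λ e → z≢xᵢ (trans e (sym (nb-unique (col-diag xᵢ xⱼ)))))) G₁.y≢x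

    y-unmovedᵢ : p Tᵢ y ≡ xᵢ
    y-unmovedᵢ = unmoved⇒p≡root Tᵢ (avoids Aᵢi Aᵢj (y∉X i) G₁.y∉Aᵢ) (avoids Bᵢi Bᵢj (y∉X i) G₁.y∉Bᵢ)

    y-childlessᵢ : ∀ u → p Tᵢ u ≢ y
    y-childlessᵢ = childless Tᵢ (y∉X i) (avoids (pᵢ-root Aᵢi) (pᵢ-root Aᵢj) (y∉X i) G₁.y∉pAᵢ)
      (avoids (pᵢ-root Bᵢi) (pᵢ-root Bᵢj) (y∉X i) G₁.y∉pBᵢ)

    y∉Aⱼ : Avoids y (A Tⱼ)
    y∉Aⱼ = avoids Aⱼi Aⱼj (y∉X j) G₁.y∉Aⱼ

    y∉Bⱼ : Avoids y (B Tⱼ)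
    y∉Bⱼ = avoids Bⱼi Bⱼj (y∉X j) G₁.y∉Bⱼ

    y-unmovedⱼ : p Tⱼ y ≡ xⱼ
    y-unmovedⱼ = unmoved⇒p≡root Tⱼ y∉Aⱼ y∉Bⱼ

    y-childlessⱼ : ∀ u → p Tⱼ u ≢ y
    y-childlessⱼ = childless Tⱼ (y∉X j) (avoids (pⱼ-root Aⱼi) (pⱼ-root Aⱼj) (y∉X j) G₁.y∉pAⱼ)
      (avoids (pⱼ-root Bⱼi) (pⱼ-root Bⱼj) (y∉X j) G₁.y∉pBⱼ)

    z∉Aᵢ : Avoids z (A Tᵢ)
    z∉Aᵢ = avoids Aᵢi Aᵢj z≢xᵢ G₁.z∉A

    module E₁ = Exchange Tᵢ xⱼ z j Aᵢj Bᵢj (xᵢ≢xⱼ ∘ sym) z≢xᵢ (z≢xⱼ ∘ sym) (proj₁ conflict)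
      (unmoved⇒p≡root Tᵢ z∉Aᵢ (avoids Bᵢi Bᵢj z≢xᵢ G₁.z∉B))
      -- By `parents`, the root `xⱼ` has no children in `Tᵢ`.
      (λ u e → xᵢ≢xⱼ (trans (sym (parents Tᵢ e)) e))
      (childless Tᵢ z≢xᵢ (avoids (pᵢ-root Aᵢi) (pᵢ-root Aᵢj) z≢xᵢ G₁.z∉pA) (avoids (pᵢ-root Bᵢi) (pᵢ-root Bᵢj) z≢xᵢ G₁.z∉pB))
      y-unmovedᵢ
      (unmoved⇒p≡root Tᵢ (avoids Aᵢi Aᵢj (z′∉X i) G₁.z′∉A) (avoids Bᵢi Bᵢj (z′∉X i) G₁.z′∉B))
      y∉X z′∉X z∉Aᵢ
      (λ xⱼ∉X → contradiction refl (xⱼ∉X j)) (λ xⱼ∉X → contradiction refl (xⱼ∉X j))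
      (avoids (pᵢ-root Bᵢi) (pᵢ-root Bᵢj) (z′∉X i) G₁.z′∉pB)

    β : Fin n
    β = col xⱼ y

    β≡ : β ≡ col xᵢ z
    β≡ = col-nb xⱼ (col xᵢ z)

    -- Likewise σ₂ t gives w′ = t, and τ₂ t gives y′ = t.
    σ₂ τ₂ : V → V
    σ₂ t = nb t β
    τ₂ t = nb xⱼ (col y t)

    β-edge : ∀ l → ∃ λ e → ∀ {v} → col v (p (tree S l) v) ≡ β → v ≡ e
    β-edge l = colour-unique (tree S l) β

    y-nbrs : ∀ l → ∃ λ t₁ → ∃ λ t₂ → ∀ {v} → NonRoot v → p (tree S l) y ≡ v ⊎ p (tree S l) v ≡ y → v ≡ t₁ ⊎ v ≡ t₂
    y-nbrs l = tree-neighbours (tree S l) y y∉X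

    -- The last two entries keep `w′` and `y′` off `xᵢ`; for `xⱼ` the entry `y` suffices, as it
    -- equals both `σ₂ xⱼ` and `τ₂ xⱼ`.
    base₂ : List V
    base₂ = xᵢ ∷ xⱼ ∷ y ∷ σ₂ xᵢ ∷ τ₂ xᵢ ∷ []

    -- The first three rows treat `w`, `w′` and `ww′` in `Tⱼ` as before. The fourth makes `y′` an
    -- unmoved non-root and a new parent for the list `A`; the fifth keeps `yy′` out of tree `l`.
    block₂ : Fin k → List V
    block₂ l =
      A Tⱼ l ∷ B Tⱼ l ∷ p Tⱼ (A Tⱼ l) ∷ p Tⱼ (B Tⱼ l) ∷ x l ∷
      σ₂ (A Tⱼ l) ∷ σ₂ (B Tⱼ l) ∷ σ₂ (p Tⱼ (B Tⱼ l)) ∷ σ₂ (x l) ∷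
      proj₁ (β-edge l) ∷ p (tree S l) (proj₁ (β-edge l)) ∷
      τ₂ (A Tⱼ l) ∷ τ₂ (B Tⱼ l) ∷ τ₂ (p Tⱼ (A Tⱼ l)) ∷ τ₂ (x l) ∷
      τ₂ (proj₁ (y-nbrs l)) ∷ τ₂ (proj₁ (proj₂ (y-nbrs l))) ∷ []

    abstract
      choice₂ : ∃ λ w → All (w ≢_) base₂ × (∀ l → l ≢ i → l ≢ j → All (w ≢_) (block₂ l))
      choice₂ = avoid i j i≢j base₂ block₂ 17 (λ _ → refl) bound₂

    -- In `Tⱼ` the edge `yy′` takes over the colour of `xⱼw`, and `ww′` the colour `β` of `xⱼy`.
    w w′ y′ : V
    w = proj₁ choice₂
    w′ = nb w β
    y′ = nb y (col xⱼ w)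

    record Good₂ (l : Fin k) : Set where
      field
        w∉A : w ≢ A Tⱼ l
        w∉B : w ≢ B Tⱼ l
        w∉pA : w ≢ p Tⱼ (A Tⱼ l)
        w∉pB : w ≢ p Tⱼ (B Tⱼ l)
        w≢x : w ≢ x l
        w′∉A : w′ ≢ A Tⱼ l
        w′∉B : w′ ≢ B Tⱼ l
        w′∉pB : w′ ≢ p Tⱼ (B Tⱼ l)
        w′≢x : w′ ≢ x l
        w≢e : w ≢ proj₁ (β-edge l)
        w≢pe : w ≢ p (tree S l) (proj₁ (β-edge l))
        y′∉A : y′ ≢ A Tⱼ l
        y′∉B : y′ ≢ B Tⱼ l
        y′∉pA : y′ ≢ p Tⱼ (A Tⱼ l)
        y′≢x : y′ ≢ x l
        y′≢t₁ : y′ ≢ proj₁ (y-nbrs l)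
        y′≢t₂ : y′ ≢ proj₁ (proj₂ (y-nbrs l))

    good₂ : ∀ l → l ≢ i → l ≢ j → Good₂ l
    good₂ l l≢i l≢j with proj₂ (proj₂ choice₂) l l≢i l≢j
    ... | c₁ ∷ c₂ ∷ c₃ ∷ c₄ ∷ c₅ ∷ c₆ ∷ c₇ ∷ c₈ ∷ c₉ ∷ c₁₀ ∷ c₁₁ ∷ c₁₂ ∷ c₁₃ ∷ c₁₄ ∷ c₁₅ ∷ c₁₆ ∷ c₁₇ ∷ [] = record
      { w∉A = c₁ ; w∉B = c₂ ; w∉pA = c₃ ; w∉pB = c₄ ; w≢x = c₅
      ; w′∉A = nb-avoid c₆ ; w′∉B = nb-avoid c₇ ; w′∉pB = nb-avoid c₈ ; w′≢x = nb-avoid c₉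
      ; w≢e = c₁₀ ; w≢pe = c₁₁
      ; y′∉A = nb-col-avoid c₁₂ ; y′∉B = nb-col-avoid c₁₃ ; y′∉pA = nb-col-avoid c₁₄ ; y′≢x = nb-col-avoid c₁₅
      ; y′≢t₁ = nb-col-avoid c₁₆ ; y′≢t₂ = nb-col-avoid c₁₇ }

    module G₂ (l : Fin k) (l≢i : l ≢ i) (l≢j : l ≢ j) = Good₂ (good₂ l l≢i l≢j)

    w≢xᵢ : w ≢ xᵢ
    w≢xᵢ with proj₁ (proj₂ choice₂)
    ... | c ∷ _ = c

    w≢xⱼ : w ≢ xⱼ
    w≢xⱼ with proj₁ (proj₂ choice₂)
    ... | _ ∷ c ∷ _ = c

    w≢y : w ≢ y
    w≢y with proj₁ (proj₂ choice₂)
    ... | _ ∷ _ ∷ c ∷ _ = c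

    w′≢xᵢ : w′ ≢ xᵢ
    w′≢xᵢ with proj₁ (proj₂ choice₂)
    ... | _ ∷ _ ∷ _ ∷ c ∷ _ = nb-avoid c

    y′≢xᵢ : y′ ≢ xᵢ
    y′≢xᵢ with proj₁ (proj₂ choice₂)
    ... | _ ∷ _ ∷ _ ∷ _ ∷ c ∷ [] = nb-col-avoid c

    w∉X : NonRoot w
    w∉X = nonRoot w≢xᵢ w≢xⱼ G₂.w≢x

    w′∉X : NonRoot w′
    w′∉X = nonRoot w′≢xᵢ (nb-avoid (λ e → w≢y (trans e (sym (nb-unique refl))))) G₂.w′≢x

    y′∉X : NonRoot y′
    y′∉X = nonRoot y′≢xᵢ (nb-col-avoid (λ e → w≢y (trans e (sym (nb-unique (col-sym xⱼ y)))))) G₂.y′≢x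

    w∉Aⱼ : Avoids w (A Tⱼ)
    w∉Aⱼ = avoids Aⱼi Aⱼj w≢xⱼ G₂.w∉A

    module E₂ = Exchange Tⱼ y w i Aⱼi Bⱼi (y∉X j) w≢xⱼ (w≢y ∘ sym) y-unmovedⱼ
      (unmoved⇒p≡root Tⱼ w∉Aⱼ (avoids Bⱼi Bⱼj w≢xⱼ G₂.w∉B))
      y-childlessⱼ
      (childless Tⱼ w≢xⱼ (avoids (pⱼ-root Aⱼi) (pⱼ-root Aⱼj) w≢xⱼ G₂.w∉pA) (avoids (pⱼ-root Bⱼi) (pⱼ-root Bⱼj) w≢xⱼ G₂.w∉pB))
      (unmoved⇒p≡root Tⱼ (avoids Aⱼi Aⱼj (y′∉X j) G₂.y′∉A) (avoids Bⱼi Bⱼj (y′∉X j) G₂.y′∉B))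
      (unmoved⇒p≡root Tⱼ (avoids Aⱼi Aⱼj (w′∉X j) G₂.w′∉A) (avoids Bⱼi Bⱼj (w′∉X j) G₂.w′∉B))
      y′∉X w′∉X w∉Aⱼ (λ _ → y∉Bⱼ)
      (λ _ → avoids (pⱼ-root Aⱼi) (pⱼ-root Aⱼj) (y′∉X j) G₂.y′∉pA)
      (avoids (pⱼ-root Bⱼi) (pⱼ-root Bⱼj) (w′∉X j) G₂.w′∉pB)

    Tᵢ′ : Tree i
    Tᵢ′ = E₁.exchange
    Tⱼ′ : Tree j
    Tⱼ′ = E₂.exchange

    z-unmoved : p Tᵢ z ≡ xᵢ
    z-unmoved = unmoved⇒p≡root Tᵢ z∉Aᵢ (avoids Bᵢi Bᵢj z≢xᵢ G₁.z∉B)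

    zz′-unused : ∀ m → m ≢ i → m ≢ j → ∀ {u} → ¬ SameEnds z z′ u (p (tree S m) u)
    zz′-unused m m≢i m≢j {u} same with proj₂ (α-edge m) (trans (sym (SameEnds-col same)) (col-nb z α))
    zz′-unused m m≢i m≢j (inj₁ (z≡u , _)) | refl = G₁.z≢e m m≢i m≢j z≡u
    zz′-unused m m≢i m≢j (inj₂ (z≡pu , _)) | refl = G₁.z≢pe m m≢i m≢j z≡pu

    ww′-unused : ∀ m → m ≢ i → m ≢ j → ∀ {u} → ¬ SameEnds w w′ u (p (tree S m) u)
    ww′-unused m m≢i m≢j {u} same with proj₂ (β-edge m) (trans (sym (SameEnds-col same)) (col-nb w β))
    ww′-unused m m≢i m≢j (inj₁ (w≡u , _)) | refl = G₂.w≢e m m≢i m≢j w≡u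
    ww′-unused m m≢i m≢j (inj₂ (w≡pu , _)) | refl = G₂.w≢pe m m≢i m≢j w≡pu

    -- Before the exchanges the edge xⱼy lies in Tⱼ, hence in no other tree.
    xⱼy-unused : ∀ m → m ≢ i → m ≢ j → ∀ {u} → ¬ SameEnds xⱼ y u (p (tree S m) u)
    xⱼy-unused m m≢i m≢j (inj₁ (xⱼ≡u , y≡pu)) =
      y∉X m (proj₁ (disj S j m (m≢j ∘ sym) (inj₂ (y≡pu , trans y-unmovedⱼ xⱼ≡u))))
    xⱼy-unused m m≢i m≢j (inj₂ (xⱼ≡pu , _)) =
      m≢j (x-inj (sym (trans xⱼ≡pu (parents (tree S m) (sym xⱼ≡pu)))))

    yy′-unused : ∀ m → m ≢ i → m ≢ j → ∀ {u} → ¬ SameEnds y y′ u (p (tree S m) u)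
    yy′-unused m m≢i m≢j {u} same = [ G₂.y′≢t₁ m m≢i m≢j , G₂.y′≢t₂ m m≢i m≢j ]′
      (proj₂ (proj₂ (y-nbrs m)) y′∉X (adjacent same))
      where
      adjacent : SameEnds y y′ u (p (tree S m) u) → p (tree S m) y ≡ y′ ⊎ p (tree S m) y′ ≡ y
      adjacent (inj₁ (refl , e)) = inj₁ (sym e)
      adjacent (inj₂ (e , refl)) = inj₂ (sym e)

    with-parent : ∀ {v t t′ u u′ : V} → t ≡ t′ → SameEnds v t u u′ → SameEnds v t′ u u′
    with-parent refl same = same

    with-parents : ∀ {v t t′ u s s′ : V} → t ≡ t′ → s ≡ s′ → SameEnds v t u s → SameEnds v t′ u s′
    with-parents refl refl same = same

    disjᵢ : ∀ m → m ≢ i → m ≢ j → Disj Tᵢ′ (tree S m)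
    disjᵢ m m≢i m≢j {v} {u} same with E₁.position v
    ... | E₁.at-a refl = ⊥-elim (xⱼy-unused m m≢i m≢j (with-parent E₁.p′-a same))
    ... | E₁.at-b refl = ⊥-elim (zz′-unused m m≢i m≢j (with-parent E₁.p′-b same))
    ... | E₁.away v≢a v≢b = disj S i m (m≢i ∘ sym) (with-parent (E₁.p′-≢ v≢a v≢b) same)

    disjⱼ : ∀ m → m ≢ i → m ≢ j → Disj Tⱼ′ (tree S m)
    disjⱼ m m≢i m≢j {v} {u} same with E₂.position v
    ... | E₂.at-a refl = ⊥-elim (yy′-unused m m≢i m≢j (with-parent E₂.p′-a same))
    ... | E₂.at-b refl = ⊥-elim (ww′-unused m m≢i m≢j (with-parent E₂.p′-b same))
    ... | E₂.away v≢a v≢b = disj S j m (m≢j ∘ sym) (with-parent (E₂.p′-≢ v≢a v≢b) same)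

    -- In `Tⱼ` this edge occurs only as the parent edge of `y`, which the second exchange removes.
    xⱼy-old : ∀ {u} → u ≢ y → ¬ SameEnds xⱼ y u (p Tⱼ u)
    xⱼy-old u≢y (inj₁ (_ , y≡pu)) = y-childlessⱼ _ (sym y≡pu)
    xⱼy-old u≢y (inj₂ (_ , y≡u)) = u≢y (sym y≡u)

    xⱼy-yy′ : ¬ SameEnds xⱼ y y y′
    xⱼy-yy′ (inj₁ (e , _)) = y∉X j (sym e)
    xⱼy-yy′ (inj₂ (e , _)) = y′∉X j (sym e)

    xⱼy-ww′ : ¬ SameEnds xⱼ y w w′
    xⱼy-ww′ (inj₁ (e , _)) = w≢xⱼ (sym e)
    xⱼy-ww′ (inj₂ (_ , e)) = w≢y (sym e)

    -- The edge of colour `α` in `Tⱼ` is `xᵢxⱼ`, and neither `z` nor `z′` is `xᵢ`.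
    zz′-old : ∀ {u} → ¬ SameEnds z z′ u (p Tⱼ u)
    zz′-old {u} same with rainbow Tⱼ {u} {xᵢ} (trans (sym (SameEnds-col same)) (trans (col-nb z α) (cong (col xᵢ) (sym (proj₂ conflict)))))
    zz′-old (inj₁ (e , _)) | refl = z≢xᵢ e
    zz′-old (inj₂ (_ , e)) | refl = z′∉X i e

    -- Equal colours of `xⱼxᵢ` and `xⱼw` would force `w = xᵢ`.
    zz′-yy′ : ¬ SameEnds z z′ y y′
    zz′-yy′ same = w≢xᵢ (col-inj (sym (trans (col-sym xⱼ xᵢ) (trans (sym (col-nb z α)) (trans (SameEnds-col same) (col-nb y _))))))

    -- Equal colours of `xᵢxⱼ` and `xᵢz` would force `z = xⱼ`.
    zz′-ww′ : ¬ SameEnds z z′ w w′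
    zz′-ww′ same = z≢xⱼ (sym (col-inj (trans (sym (col-nb z α)) (trans (SameEnds-col same) (trans (col-nb w β) β≡)))))

    -- The only edge of `Tᵢ` at the leaf `y` is `xᵢy`, and `y′` is not `xᵢ`.
    old-yy′ : ∀ {v} → ¬ SameEnds v (p Tᵢ v) y y′
    old-yy′ (inj₁ (refl , e)) = y′≢xᵢ (trans (sym e) y-unmovedᵢ)
    old-yy′ (inj₂ (_ , e)) = y-childlessᵢ _ e

    -- The edge of colour `β` in `Tᵢ` is `xᵢz`, which the first exchange removes.
    old-ww′ : ∀ {v} → v ≢ z → ¬ SameEnds v (p Tᵢ v) w w′
    old-ww′ {v} v≢z same = v≢z (rainbow Tᵢ (trans (SameEnds-col same)
      (trans (col-nb w β) (trans β≡ (trans (col-sym xᵢ z) (cong (col z) (sym z-unmoved)))))))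

    disjᵢⱼ : Disj Tᵢ′ Tⱼ′
    disjᵢⱼ {v} {u} same with E₁.position v | E₂.position u
    ... | E₁.at-a refl | E₂.at-a refl = ⊥-elim (xⱼy-yy′ (with-parents E₁.p′-a E₂.p′-a same))
    ... | E₁.at-a refl | E₂.at-b refl = ⊥-elim (xⱼy-ww′ (with-parents E₁.p′-a E₂.p′-b same))
    ... | E₁.at-a refl | E₂.away u≢y u≢w = ⊥-elim (xⱼy-old u≢y (with-parents E₁.p′-a (E₂.p′-≢ u≢y u≢w) same))
    ... | E₁.at-b refl | E₂.at-a refl = ⊥-elim (zz′-yy′ (with-parents E₁.p′-b E₂.p′-a same))
    ... | E₁.at-b refl | E₂.at-b refl = ⊥-elim (zz′-ww′ (with-parents E₁.p′-b E₂.p′-b same))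
    ... | E₁.at-b refl | E₂.away u≢y u≢w = ⊥-elim (zz′-old (with-parents E₁.p′-b (E₂.p′-≢ u≢y u≢w) same))
    ... | E₁.away v≢xⱼ v≢z | E₂.at-a refl = ⊥-elim (old-yy′ (with-parents (E₁.p′-≢ v≢xⱼ v≢z) E₂.p′-a same))
    ... | E₁.away v≢xⱼ v≢z | E₂.at-b refl = ⊥-elim (old-ww′ v≢z (with-parents (E₁.p′-≢ v≢xⱼ v≢z) E₂.p′-b same))
    ... | E₁.away v≢xⱼ v≢z | E₂.away u≢y u≢w =
      contradiction (proj₁ (disj S i j i≢j (with-parents (E₁.p′-≢ v≢xⱼ v≢z) (E₂.p′-≢ u≢y u≢w) same))) v≢xⱼ

    data View : Fin k → Set where
      isᵢ : View i
      isⱼ : View j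
      other : ∀ {m} → m ≢ i → m ≢ j → View m

    view : ∀ m → View m
    view = for-all isᵢ isⱼ (λ _ → other)

    pick : ∀ {m} → View m → Tree m
    pick isᵢ = Tᵢ′
    pick isⱼ = Tⱼ′
    pick {m} (other _ _) = tree S m

    disj-pick : ∀ {l m} (vl : View l) (vm : View m) → l ≢ m → Disj (pick vl) (pick vm)
    disj-pick isᵢ isᵢ l≢m = contradiction refl l≢m
    disj-pick isᵢ isⱼ l≢m = disjᵢⱼ
    disj-pick isᵢ (other m≢i m≢j) l≢m = disjᵢ _ m≢i m≢j
    disj-pick isⱼ isᵢ l≢m = Disj-sym {T = Tᵢ′} {Tⱼ′} disjᵢⱼ
    disj-pick isⱼ isⱼ l≢m = contradiction refl l≢m
    disj-pick isⱼ (other m≢i m≢j) l≢m = disjⱼ _ m≢i m≢j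
    disj-pick {l} (other l≢i l≢j) isᵢ l≢m = Disj-sym {T = Tᵢ′} {tree S l} (disjᵢ l l≢i l≢j)
    disj-pick {l} (other l≢i l≢j) isⱼ l≢m = Disj-sym {T = Tⱼ′} {tree S l} (disjⱼ l l≢i l≢j)
    disj-pick (other _ _) (other _ _) l≢m = disj S _ _ l≢m

    -- No conflict arises anew: the only root that moves is `xⱼ`, in `Tᵢ`, and it hung from `xᵢ`
    -- before.
    pull : ∀ {l} (vl : View l) m → p (pick vl) (x m) ≡ x l → p (tree S l) (x m) ≡ x l
    pull isᵢ m e with E₁.position (x m)
    ... | E₁.at-a xm≡ = trans (cong (p Tᵢ) xm≡) (proj₁ conflict)
    ... | E₁.at-b xm≡ = contradiction (sym xm≡) (z∉X m)
    ... | E₁.away ≢a ≢b = trans (sym (E₁.p′-≢ ≢a ≢b)) e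
    pull isⱼ m e with E₂.position (x m)
    ... | E₂.at-a xm≡ = contradiction (sym xm≡) (y∉X m)
    ... | E₂.at-b xm≡ = contradiction (sym xm≡) (w∉X m)
    ... | E₂.away ≢a ≢b = trans (sym (E₂.p′-≢ ≢a ≢b)) e
    pull (other _ _) m e = e

    -- In the new tree `xⱼ` hangs from the non-root `y`. The equation `l ≡ i` makes this usable for
    -- `view i`, which does not reduce to `isᵢ`.
    resolved : ∀ {l} (vl : View l) → l ≡ i → p (pick vl) xⱼ ≢ x l
    resolved isᵢ _ e = y∉X i (trans (sym E₁.p′-a) e)
    resolved isⱼ j≡i _ = i≢j (sym j≡i)
    resolved (other l≢i _) l≡i _ = l≢i l≡i

    -- The two slots filled belong to the pair `i`, `j`, which is no longer in conflict.
    idle-pick : ∀ {l m} (vl : View l) (vm : View m) →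
      p (pick vl) (x m) ≡ x l → p (pick vm) (x l) ≡ x m → A (pick vl) m ≡ x l × B (pick vl) m ≡ x l
    idle-pick {l} {m} isᵢ vm e e′ with m ≟ j
    ... | yes refl = contradiction e (resolved isᵢ refl)
    ... | no m≢j = idle S i m (pull isᵢ m e , pull vm i e′)
    idle-pick {l} {m} isⱼ vm e e′ with m ≟ i
    ... | yes refl = contradiction e′ (resolved vm refl)
    ... | no m≢i = idle S j m (pull isⱼ m e , pull vm j e′)
    idle-pick {l} {m} (other l≢i l≢j) vm e e′ = idle S l m (e , pull vm l e′)

    S′ : State
    S′ = record
      { tree = λ m → pick (view m)
      ; idle = λ l m (e , e′) → idle-pick (view l) (view m) e e′
      ; disj = λ l m → disj-pick (view l) (view m) }

    resolve : ∃ λ S′ → ¬ Conflict S′ i j × (∀ {l m} → Conflict S′ l m → Conflict S l m)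
    resolve = S′ , (λ (e , _) → resolved (view i) refl e) ,
      λ {l} {m} (e , e′) → pull (view l) m e , pull (view m) l e′

  -- Resolving all conflicts.

  module _ (bound₁ : ∀ q → k ≡ 2 + q → 2 + q * 20 < n) (bound₂ : ∀ q → k ≡ 2 + q → 5 + q * 17 < n) where

    -- Since resolving one pair creates no conflict, the pairs treated earlier stay free.
    resolve-all : (L : List (Fin k × Fin k)) → ∃ λ S → ∀ {l m} → (l , m) ∈ L → l ≢ m → ¬ Conflict S l m
    resolve-all [] = stars , λ ()
    resolve-all ((i , j) ∷ L) with resolve-all L
    ... | S , done with i ≟ j | p (tree S i) (x j) ≟ x i ×-dec p (tree S j) (x i) ≟ x j
    ... | yes refl | _ = S , λ { (here refl) l≢m → contradiction refl l≢m ; (there lm∈) → done lm∈ }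
    ... | no _ | no free = S , λ { (here refl) _ → free ; (there lm∈) → done lm∈ }
    ... | no i≢j | yes conflict with Resolve.resolve S i j i≢j conflict bound₁ bound₂
    ... | S′ , free , fewer = S′ , λ { (here refl) _ → free ; (there lm∈) l≢m → done lm∈ l≢m ∘ fewer }

    disjoint-trees : ∃ λ (T : ∀ i → Tree i) → ∀ l m → l ≢ m → ∀ {v w} → ¬ SameEnds v (p (T l) v) w (p (T m) w)
    disjoint-trees with resolve-all (cartesianProduct (allFin k) (allFin k))
    ... | S , done = tree S , separate
      where
      separate : ∀ l m → l ≢ m → ∀ {v w} → ¬ SameEnds v (p (tree S l) v) w (p (tree S m) w)
      separate l m l≢m same with disj S l m l≢m same
      separate l m l≢m (inj₁ (e , _)) | refl , refl = l≢m (x-inj (sym e))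
      separate l m l≢m (inj₂ (e , e′)) | refl , refl =
        done (∈-cartesianProduct⁺ (∈-allFin l) (∈-allFin m)) l≢m (e′ , sym e)

-- From edge colourings to Latin squares.

edge-≡ : ∀ {n} {e f : Edge n} → SameEnds (u e) (v e) (u f) (v f) → e ≡ f
edge-≡ {e = edge a b lt} {edge _ _ lt′} (inj₁ (refl , refl)) = cong (edge a b) (<-irrelevant lt lt′)
edge-≡ {e = edge a b lt} {edge _ _ gt} (inj₂ (refl , refl)) = contradiction lt (<-asym gt)

join : ∀ {n} (a b : Fin n) → a ≢ b → ∃ λ e → SameEnds (u e) (v e) a b
join a b a≢b with <-cmp a b
... | tri< lt _ _ = edge a b lt , inj₁ (refl , refl)
... | tri≈ _ a≡b _ = contradiction a≡b a≢b
... | tri> _ _ gt = edge b a gt , inj₂ (refl , refl)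

SameEnds-trans : ∀ {A : Set} {a a′ b b′ c c′ : A} → SameEnds a a′ b b′ → SameEnds b b′ c c′ → SameEnds a a′ c c′
SameEnds-trans (inj₁ (refl , refl)) same = same
SameEnds-trans (inj₂ (refl , refl)) (inj₁ (refl , refl)) = inj₂ (refl , refl)
SameEnds-trans (inj₂ (refl , refl)) (inj₂ (refl , refl)) = inj₁ (refl , refl)

SameEnds-cancelˡ : ∀ {A : Set} {a b d : A} → SameEnds a b a d → b ≡ d
SameEnds-cancelˡ (inj₁ (_ , e)) = e
SameEnds-cancelˡ (inj₂ (refl , e)) = e

endpointˡ : ∀ {n} {e : Edge n} {a b} → SameEnds (u e) (v e) a b → a ∈ₑ e
endpointˡ (inj₁ (e , _)) = inj₁ (sym e)
endpointˡ (inj₂ (_ , e)) = inj₂ (sym e)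

-- The colouring as a symmetric Latin square whose diagonal carries the extra symbol zero.
module Square {N : ℕ} (c : Colouring (suc N) N) (proper : Proper c) where

  V : Set
  V = Fin (suc N)

  col : V → V → V
  col a b with a ≟ b
  ... | yes _ = zero
  ... | no a≢b = suc (c (proj₁ (join a b a≢b)))

  col-edge : ∀ {a b} (e : Edge (suc N)) → SameEnds (u e) (v e) a b → col a b ≡ suc (c e)
  col-edge {a} {b} e ends with a ≟ b
  col-edge e (inj₁ (refl , refl)) | yes u≡v = contradiction (u<v e) (<-irrefl u≡v)
  col-edge e (inj₂ (refl , refl)) | yes v≡u = contradiction (u<v e) (<-irrefl (sym v≡u))
  col-edge e ends | no a≢b = cong (suc ∘ c) (edge-≡ (SameEnds-trans (proj₂ (join _ _ a≢b)) (SameEnds-sym ends)))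

  col-self : ∀ a → col a a ≡ zero
  col-self a with a ≟ a
  ... | yes _ = refl
  ... | no a≢a = contradiction refl a≢a

  col-diag : ∀ a b → col a a ≡ col b b
  col-diag a b = trans (col-self a) (sym (col-self b))

  col-sym : ∀ a b → col a b ≡ col b a
  col-sym a b with a ≟ b
  ... | yes refl = sym (col-self a)
  ... | no a≢b = sym (col-edge _ (SameEnds-trans (proj₂ (join a b a≢b)) (inj₂ (refl , refl))))

  col-inj : ∀ {a b d} → col a b ≡ col a d → b ≡ d
  col-inj {a} {b} {d} same with a ≟ b | a ≟ d
  ... | yes refl | yes refl = refl
  ... | yes _ | no _ = contradiction same λ ()
  ... | no _ | yes _ = contradiction same λ ()
  ... | no a≢b | no a≢d with join a b a≢b | join a d a≢d | b ≟ d
  ... | _ | _ | yes b≡d = b≡d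
  ... | e , e-ends | f , f-ends | no b≢d = contradiction (suc-injective same)
    (proper e f (λ { refl → b≢d (SameEnds-cancelˡ (SameEnds-trans (SameEnds-sym e-ends) f-ends)) })
      (a , endpointˡ {e = e} e-ends , endpointˡ {e = f} f-ends))

  -- Parent maps as spanning trees.

  module ParentTree (r : V) (p : V → V) (root : p r ≡ r) (depth : ∀ v → p (p v) ≡ r)
    (rainbow : ∀ {v w} → col v (p v) ≡ col w (p w) → v ≡ w) where

    no-loop : ∀ {v} → v ≢ r → v ≢ p v
    no-loop {v} v≢r v≡pv = v≢r (trans v≡pv (trans (cong p v≡pv) (depth v)))

    vertex : Fin N → V
    vertex = punchIn r

    parent-edge : ∀ t → ∃ λ e → SameEnds (u e) (v e) (vertex t) (p (vertex t))
    parent-edge t = join (vertex t) (p (vertex t)) (no-loop (punchInᵢ≢i r t))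

    tree : Subgraph (suc N)
    tree = tabulate (proj₁ ∘ parent-edge)

    ∈-tree : ∀ {e} → e ∈ tree → ∃ λ a → a ≢ r × SameEnds (u e) (v e) a (p a)
    ∈-tree e∈ with ∈-tabulate⁻ e∈
    ... | t , refl = vertex t , punchInᵢ≢i r t , proj₂ (parent-edge t)

    Up : V → V → Set
    Up a b = a ≢ r × p a ≡ b

    Adj⇒Up : ∀ {a b} → Adj tree a b → Up a b ⊎ Up b a
    Adj⇒Up {a} {b} (e , e∈ , ends) with ∈-tree e∈
    ... | w , w≢r , same with ends
    ... | inj₁ (refl , refl) = up same
      where
      up : SameEnds (u e) (v e) w (p w) → Up (u e) (v e) ⊎ Up (v e) (u e)
      up (inj₁ (refl , e′)) = inj₁ (w≢r , sym e′)
      up (inj₂ (e′ , refl)) = inj₂ (w≢r , sym e′)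
    ... | inj₂ (refl , refl) = up same
      where
      up : SameEnds (u e) (v e) w (p w) → Up (v e) (u e) ⊎ Up (u e) (v e)
      up (inj₁ (refl , e′)) = inj₂ (w≢r , sym e′)
      up (inj₂ (e′ , refl)) = inj₁ (w≢r , sym e′)

    Adj-sym : ∀ {T : Subgraph (suc N)} {a b} → Adj T a b → Adj T b a
    Adj-sym (e , e∈ , ends) = e , e∈ , swap (map-⊎ (λ (s , t) → t , s) (λ (s , t) → t , s) ends)

    Adj-parent : ∀ {a} → a ≢ r → Adj tree a (p a)
    Adj-parent {a} a≢r = subst (λ b → Adj tree b (p b)) (punchIn-punchOut (a≢r ∘ sym))
      (proj₁ (parent-edge t) , ∈-tabulate⁺ t , ends (proj₂ (parent-edge t)))
      where
      t = punchOut {i = r} (a≢r ∘ sym)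
      ends : ∀ {s s′ a b : V} → SameEnds s s′ a b → (a ≡ s × b ≡ s′) ⊎ (a ≡ s′ × b ≡ s)
      ends (inj₁ (refl , refl)) = inj₁ (refl , refl)
      ends (inj₂ (refl , refl)) = inj₂ (refl , refl)

    _⋆_ : ∀ {T : Subgraph (suc N)} {a b d} → Walk T a b → Walk T b d → Walk T a d
    here ⋆ ds = ds
    step s bs ⋆ ds = step s (bs ⋆ ds)

    reverse : ∀ {T : Subgraph (suc N)} {a b} → Walk T a b → Walk T b a
    reverse here = here
    reverse (step s ws) = reverse ws ⋆ step (Adj-sym s) here

    to-parent : ∀ a → Walk tree a (p a)
    to-parent a with a ≟ r
    ... | yes refl = subst (Walk tree r) (sym root) here
    ... | no a≢r = step (Adj-parent a≢r) here

    to-root : ∀ a → Walk tree a r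
    to-root a = to-parent a ⋆ subst (Walk tree (p a)) (depth a) (to-parent (p a))

    connected : Connected tree
    connected a b = to-root a ⋆ reverse (to-root b)

    -- The only way up from `b` leads back to `a`.
    turn : ∀ {a b d} → Up b a → Adj tree b d → a ≢ d → Up d b
    turn (_ , pb≡a) bd a≢d with Adj⇒Up bd
    ... | inj₁ (_ , pb≡d) = contradiction (trans (sym pb≡a) pb≡d) a≢d
    ... | inj₂ down = down

    -- Both `a` and `b` would be grandparents, hence the root.
    no-triple : ∀ {a b d e} → a ≢ b → Up b a → Up d b → Up e d → ⊥
    no-triple a≢b (_ , refl) (_ , refl) (_ , refl) = a≢b (trans (depth _) (sym (depth _)))

    -- A path that has once moved away from the root never turns back, so it soon exceeds depth two.
    dead-end₂ : ∀ {f a b d rest} → a ≢ b → Up b a → Up d b → b ≢ f → All (b ≢_) rest → ¬ ClosedChain tree f (d ∷ rest)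
    dead-end₂ a≢b ba db b≢f _ (last df) = no-triple a≢b ba db (turn db df b≢f)
    dead-end₂ a≢b ba db b≢f (b≢e ∷ _) (cons de _) = no-triple a≢b ba db (turn db de b≢e)

    -- After the step down to `b` the chain must close at once, since a second step down leads to a
    -- dead end.
    dead-end₁ : ∀ {f a b rest} → a ≢ b → Up b a → a ≢ f → b ≢ f → All (a ≢_) rest → Unique (b ∷ rest) →
      ClosedChain tree f (b ∷ rest) → Up f b
    dead-end₁ a≢b ba a≢f b≢f _ _ (last bf) = turn ba bf a≢f
    dead-end₁ a≢b ba a≢f b≢f (a≢d ∷ _) ((_ ∷ b≢) ∷ _) (cons bd ds) =
      ⊥-elim (dead-end₂ a≢b ba (turn ba bd a≢d) b≢f b≢ ds)

    acyclic : Acyclic tree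
    acyclic (_ , [] , s≤s () , _)
    acyclic (_ , _ ∷ [] , s≤s (s≤s ()) , _)
    acyclic (x₀ , x₁ ∷ x₂ ∷ xs , _ , (x₀≢x₁ ∷ x₀≢x₂ ∷ x₀≢xs) ∷ (x₁≢x₂ ∷ x₁≢xs) ∷ x₂≢xs ∷ unique , cons x₀x₁ (cons x₁x₂ chain))
      with Adj⇒Up x₀x₁ | Adj⇒Up x₁x₂
    ... | inj₂ down | _ = dead-end₂ x₀≢x₁ down (turn down x₁x₂ x₀≢x₂) (x₀≢x₁ ∘ sym) x₁≢xs chain
    ... | inj₁ (_ , px₀≡x₁) | inj₂ down =
      x₁≢x₂ (trans (sym px₀≡x₁) (proj₂ (dead-end₁ x₁≢x₂ down (x₀≢x₁ ∘ sym) (x₀≢x₂ ∘ sym) x₁≢xs (x₂≢xs ∷ unique) chain)))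
    -- Two steps up end at the root `x₂`. From there the cycle can only descend, and closing it
    -- would give `x₀` a second parent.
    ... | inj₁ (_ , refl) | inj₁ (_ , refl) = at-root x₀≢xs x₁≢xs x₂≢xs unique chain
      where
      at-root : ∀ {xs} → All (x₀ ≢_) xs → All (x₁ ≢_) xs → All (x₂ ≢_) xs → Unique xs → ¬ ClosedChain tree x₀ (x₂ ∷ xs)
      at-root _ _ _ _ (last x₂x₀) with Adj⇒Up x₂x₀
      ... | inj₁ (x₂≢r , _) = x₂≢r (depth x₀)
      ... | inj₂ (_ , e) = x₁≢x₂ e
      at-root (x₀≢x₃ ∷ _) (x₁≢x₃ ∷ _) (x₂≢x₃ ∷ x₂≢) unique (cons x₂x₃ rest) with Adj⇒Up x₂x₃
      ... | inj₁ (x₂≢r , _) = x₂≢r (depth x₀)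
      ... | inj₂ down = x₁≢x₃ (proj₂ (dead-end₁ x₂≢x₃ down (x₀≢x₂ ∘ sym) (x₀≢x₃ ∘ sym) x₂≢ unique rest))

    colours-injective : ∀ {s t} → c (proj₁ (parent-edge s)) ≡ c (proj₁ (parent-edge t)) → s ≡ t
    colours-injective {s} {t} same = punchIn-injective r s t (rainbow
      (trans (col-edge _ (proj₂ (parent-edge s))) (trans (cong suc same) (sym (col-edge _ (proj₂ (parent-edge t)))))))

    rainbow-tree : Rainbow c tree
    rainbow-tree = subst Unique (sym (map-tabulate (proj₁ ∘ parent-edge) c)) (Unique-tabulate⁺ colours-injective)

    spanning : SpanningTree tree
    spanning = Unique-tabulate⁺ (colours-injective ∘ cong c) , connected , acyclic

  packing : ∀ k → k ≤ suc N → (∀ q → k ≡ 2 + q → 2 + q * 20 < suc N) → (∀ q → k ≡ 2 + q → 5 + q * 17 < suc N) →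
    Σ (List (Subgraph (suc N))) λ ts →
      k ≤ length ts × All (λ T → SpanningTree T × Rainbow c T) ts × AllPairs EdgeDisjoint ts
  packing k k≤ bound₁ bound₂ with disjoint-trees bound₁ bound₂
    -- The first `k` vertices serve as the roots.
    where open Packing {k = k} col col-sym col-inj col-diag (λ i → inject≤ i k≤) (inject≤-injective k≤ k≤ _ _)
  ... | T , separate = tabulate G.tree , ≤-reflexive (sym (length-tabulate G.tree)) ,
      All-tabulate⁺ (λ i → G.spanning i , G.rainbow-tree i) , AllPairs-tabulate⁺ edge-disjoint
    where
    open Packing {k = k} col col-sym col-inj col-diag (λ i → inject≤ i k≤) (inject≤-injective k≤ k≤ _ _)
    module G (i : Fin k) = ParentTree (inject≤ i k≤) (Tree.p (T i)) (Tree.root (T i)) (Tree.depth (T i)) (Tree.rainbow (T i))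
    edge-disjoint : ∀ {l m} → l ≢ m → EdgeDisjoint (G.tree l) (G.tree m)
    edge-disjoint {l} {m} l≢m e e∈l e∈m with G.∈-tree l e∈l | G.∈-tree m e∈m
    ... | _ , _ , ends | _ , _ , ends′ = separate l m l≢m (SameEnds-trans (SameEnds-sym ends) ends′)

-- Numerical bounds on the excluded vertices.

24q≤9q²+18 : ∀ q → 24 * q ≤ 9 * (q * q) + 18
24q≤9q²+18 0 = z≤n
24q≤9q²+18 1 = m≤m+n 24 3
24q≤9q²+18 2 = m≤m+n 48 6
-- Shifted by 3, the difference is `9q² + 30q + 27`, with positive coefficients only.
24q≤9q²+18 (suc (suc (suc q))) = ≤-trans (m≤m+n _ (27 + 30 * q + 9 * (q * q))) (≤-reflexive (identity q))
  where
  identity : ∀ q → 24 * (3 + q) + (27 + 30 * q + 9 * (q * q)) ≡ 9 * ((3 + q) * (3 + q)) + 18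
  identity = solve-∀

15q≤9q²+9 : ∀ q → 15 * q ≤ 9 * (q * q) + 9
15q≤9q²+9 0 = z≤n
15q≤9q²+9 1 = m≤m+n 15 3
15q≤9q²+9 (suc (suc q)) = ≤-trans (m≤m+n _ (15 + 21 * q + 9 * (q * q))) (≤-reflexive (identity q))
  where
  identity : ∀ q → 15 * (2 + q) + (15 + 21 * q + 9 * (q * q)) ≡ 9 * ((2 + q) * (2 + q)) + 9
  identity = solve-∀

module _ (m q : ℕ) (bound : (3 * (2 + q)) * (3 * (2 + q)) ≤ 6 * m + 9) where

  -- For `k = 2 + q` and `n = 2m` this is `3k² - 3 ≤ n`, multiplied by 3.
  quadratic : 9 * (q * q) + 36 * q + 27 ≤ 3 * (2 * m)
  quadratic = +-cancelʳ-≤ 9 _ _ (≤-trans (≤-reflexive (lhs q)) (≤-trans bound (≤-reflexive (rhs m))))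
    where
    lhs : ∀ q → 9 * (q * q) + 36 * q + 27 + 9 ≡ (3 * (2 + q)) * (3 * (2 + q))
    lhs = solve-∀
    rhs : ∀ m → 6 * m + 9 ≡ 3 * (2 * m) + 9
    rhs = solve-∀

  choices₁ : 2 + q * 20 < 2 * m
  choices₁ = *-cancelˡ-≤ 3 (≤-trans (≤-reflexive (lhs q))
    (≤-trans (+-monoˡ-≤ (36 * q + 9) (24q≤9q²+18 q)) (≤-trans (≤-reflexive (rhs q)) quadratic)))
    where
    lhs : ∀ q → 3 * (3 + q * 20) ≡ 24 * q + (36 * q + 9)
    lhs = solve-∀
    rhs : ∀ q → 9 * (q * q) + 18 + (36 * q + 9) ≡ 9 * (q * q) + 36 * q + 27
    rhs = solve-∀

  choices₂ : 5 + q * 17 < 2 * m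
  choices₂ = *-cancelˡ-≤ 3 (≤-trans (≤-reflexive (lhs q))
    (≤-trans (+-monoˡ-≤ (36 * q + 18) (15q≤9q²+9 q)) (≤-trans (≤-reflexive (rhs q)) quadratic)))
    where
    lhs : ∀ q → 3 * (6 + q * 17) ≡ 15 * q + (36 * q + 18)
    lhs = solve-∀
    rhs : ∀ q → 9 * (q * q) + 9 + (36 * q + 18) ≡ 9 * (q * q) + 36 * q + 27
    rhs = solve-∀

k≤2m : ∀ m → m ≥ 1 → ∀ k → (3 * k) * (3 * k) ≤ 6 * m + 9 → k ≤ 2 * m
k≤2m _ _ 0 _ = z≤n
k≤2m (suc _) _ 1 _ = s≤s z≤n
k≤2m m _ (suc (suc q)) bound = ≤-trans (≤-trans (+-monoʳ-≤ 2 (m≤m*n q 20)) (n≤1+n _)) (choices₁ m q bound)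

-- Ranging over all `k` with `(3k)² ≤ 6m + 9` expresses the floor of the square root within the
-- natural numbers.
theorem2p1 : (m : ℕ) → m ≥ 1 →
    (c : Colouring (2 * m) (2 * m ∸ 1)) → Proper c →
    (k : ℕ) → (3 * k) * (3 * k) ≤ 6 * m + 9 →
    Σ (List (Subgraph (2 * m))) λ ts →
    k ≤ length ts × All (λ T → SpanningTree T × Rainbow c T) ts × AllPairs EdgeDisjoint ts
theorem2p1 m@(suc _) m≥1 c proper k bound = Square.packing c proper k (k≤2m m m≥1 k bound)
  (λ { q refl → choices₁ m q bound }) (λ { q refl → choices₂ m q bound })
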